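{- Let $(\pi_1,\ldots,\pi_n)$ be an autotopy of $C\in\mathcal{P}^n(v,k,\lambda)$. Then any component $\pi_x$ uniquely determines all other components. (That is, if $(\pi_1,\ldots,\pi_n)$ and $(\rho_1,\ldots,\rho_n)$ are autotopies of $C$ and $\pi_x=\rho_x$ for some $x\in\{1,\ldots,n\}$, then $\pi_y=\rho_y$ for all $y\in\{1,\ldots,n\}$.)
   Context: An incidence matrix of a symmetric $(v,k,\lambda)$ design is a $v\times v$ matrix $A$ with $\{0,1\}$-entries satisfying $AA^t=(k-\lambda)I+\lambda J$, where $I$ is the identity matrix and $J$ the all-ones matrix; parameters are assumed nondegenerate, $0\le\lambda<k$. For $n\ge 2$, $\mathcal{P}^n(v,k,\lambda)$ is the set of all functions $C:\{1,\ldots,v\}^n\to\{0,1\}$ such that for all $1\le x<y\le n$ the $2$-projection $\Pi_{xy}(C)$ is an incidence matrix of a symmetric $(v,k,\lambda)$ design; here $\Pi_{xy}(C)$ is the $v\times v$ matrix whose $(i_x,i_y)$-entry is the sum (in characteristic $0$) of $C(i_1,\ldots,i_n)$ over all $n$-tuples in $\{1,\ldots,v\}^n$ with the given coordinates $i_x,i_y$. An autotopy of $C$ is an $n$-tuple $(\pi_1,\ldots,\pi_n)\in (S_v)^n$ such that $C(i_1,\ldots,i_n)=C(\pi_1^{ -1}(i_1),\ldots,\pi_n^{ -1}(i_n))$ for all $i_1,\ldots,i_n\in\{1,\ldots,v\}$. -}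

module Defs where

open import Algebra.Properties.Semiring.Sum using (sum)
open import Data.Bool.Base using (if_then_else_)
open import Data.Fin.Base using (Fin; toℕ; _<_)
open import Data.Fin.Permutation using (Permutation′; _⟨$⟩ˡ_)
open import Data.Fin.Properties using (_≟_)
open import Data.List.Base as List using (List; allFin; cartesianProductWith; filter)
open import Data.Nat.Base using (ℕ; zero; suc; _+_; _*_; _∸_)
open import Data.Nat.ListAction as ListAction using ()
open import Data.Nat.Properties using (+-*-semiring)
open import Data.Product.Base using (_×_)
open import Data.Sum.Base using (_⊎_)
open import Data.Vec.Base using (Vec; []; _∷_; lookup; zipWith)
open import Level using (0ℓ)
open import Relation.Binary.PropositionalEquality.Core using (_≡_)
open import Relation.Nullary.Decidable using (does; _×-dec_)
open import Relation.Unary using (Pred)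

infixl 6 _⊕_
infixl 7 _⊗_ _·_
infix 8 _ᵀ
infix 4 _≐_

Matrix : ℕ → ℕ → Set
Matrix r c = Fin r → Fin c → ℕ

_≐_ : ∀ {r c} → Matrix r c → Matrix r c → Set
A ≐ B = ∀ i j → A i j ≡ B i j

_⊕_ : ∀ {r c} → Matrix r c → Matrix r c → Matrix r c
(A ⊕ B) i j = A i j + B i j

_·_ : ∀ {r c} → ℕ → Matrix r c → Matrix r c
(a · A) i j = a * A i j

_⊗_ : ∀ {r m c} → Matrix r m → Matrix m c → Matrix r c
(A ⊗ B) i j = sum +-*-semiring (λ h → A i h * B h j)

_ᵀ : ∀ {r c} → Matrix r c → Matrix c r
(A ᵀ) i j = A j i

I : ∀ {v} → Matrix v v
I i j = if does (i ≟ j) then 1 else 0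

J : ∀ {v} → Matrix v v
J i j = 1

-- The parameter λ is written l.  Truncated subtraction agrees with k - l
-- because nondegeneracy, l < k, is assumed wherever this is used.
record IsIncidenceMatrix (v k l : ℕ) (A : Matrix v v) : Set where
  field
    zero-one : ∀ i j → A i j ≡ 0 ⊎ A i j ≡ 1
    gram     : A ⊗ A ᵀ ≐ (k ∸ l) · I ⊕ l · J

-- Tuples are inductive vectors, so that pointwise equal tuples are
-- propositionally equal and every function on them is extensional.
Cube : ℕ → ℕ → Set
Cube n v = Vec (Fin v) n → Fin 2

tuples : ∀ n v → List (Vec (Fin v) n)
tuples zero    v = List.[ [] ]
tuples (suc n) v = cartesianProductWith _∷_ (allFin v) (tuples n v)

projection : ∀ {n v} → Fin n → Fin n → Cube n v → Matrix v v
projection {n} {v} x y C iₓ iᵧ =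
  ListAction.sum
    (List.map (λ t → toℕ (C t))
      (filter (λ t → (lookup t x ≟ iₓ) ×-dec (lookup t y ≟ iᵧ)) (tuples n v)))

𝒫 : ∀ n (v k l : ℕ) → Pred (Cube n v) 0ℓ
𝒫 n v k l C = ∀ (x y : Fin n) → x < y → IsIncidenceMatrix v k l (projection x y C)

-- _⟨$⟩ˡ_ applies the inverse of a permutation.
IsAutotopy : ∀ {n v} → Cube n v → Vec (Permutation′ v) n → Set
IsAutotopy C π = ∀ t → C t ≡ C (zipWith _⟨$⟩ˡ_ π t)

{-# OPTIONS --safe #-}

-- An autotopy (π₁,…,πₙ) of C leaves every 2-projection A = Π_xy(C) invariant:
-- A(i,j) = A(π_x⁻¹ i, π_y⁻¹ j).  If π_x = ρ_x, then the columns of A indexed by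
-- π_y⁻¹ j and ρ_y⁻¹ j therefore coincide (the rows, if y precedes x), and it
-- remains to see that an incidence matrix has distinct rows and columns.
-- For rows this is read off AAᵗ.  For columns one needs that A is invertible on
-- both sides: with α = (k-λ)+vλ and B = Aᵗ(αI-λJ) one has AB = α(k-λ)I, and since
-- BA is symmetric, comparing traces gives BA = α(k-λ)I as well.
module Submission where

open import Defs
open import Algebra.Properties.Semiring.Sum as Sum using ()
open import Data.Fin.Base using (Fin; zero; suc; toℕ)
open import Data.Fin.Permutation
  using (Permutation′; _≈_; _⟨$⟩ˡ_; _⟨$⟩ʳ_; inverseˡ; inverseʳ)
open import Data.Fin.Properties using (_≟_; <-cmp)
open import Data.Integer.Base as ℤ using (ℤ; +_; 0ℤ; 1ℤ; +≤+)
import Data.Integer.Properties as ℤ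
open import Data.Integer.Tactic.RingSolver using (solve-∀)
open import Data.List.Base as List using (List; filter)
open import Data.List.Membership.Propositional using () renaming (_∈_ to _∈ˡ_)
open import Data.List.Membership.Propositional.Properties
  using (∈-allFin; ∈-cartesianProductWith⁺; ∈-filter⁺; ∈-filter⁻; ∈-map⁺; ∈-map⁻)
open import Data.List.Membership.Propositional.Properties.WithK using (unique∧set⇒bag)
open import Data.List.Properties using (map-cong; map-∘)
open import Data.List.Relation.Binary.BagAndSetEquality using (∼bag⇒↭)
open import Data.List.Relation.Binary.Permutation.Propositional using (_↭_)
import Data.List.Relation.Binary.Permutation.Propositional.Properties as ↭
open import Data.List.Relation.Unary.All using ([])
open import Data.List.Relation.Unary.AllPairs using ([]; _∷_)
open import Data.List.Relation.Unary.Any using (here)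
open import Data.List.Relation.Unary.Unique.Propositional using (Unique)
import Data.List.Relation.Unary.Unique.Propositional.Properties as Unique
open import Data.Nat.Base as ℕ using (ℕ; zero; suc; _≤_; _<_)
open import Data.Nat.ListAction using (sum)
open import Data.Nat.ListAction.Properties using (sum-↭)
import Data.Nat.Properties as ℕ
open import Data.Product.Base using (_,_)
open import Data.Sum.Base using ([_,_]′)
open import Data.Vec.Base using (Vec; []; _∷_; lookup; zipWith)
open import Data.Vec.Properties using (∷-injective; lookup-zipWith)
open import Function.Base using (_∘_; _$_; id)
open import Function.Bundles using (mk⇔)
open import Relation.Binary.Definitions using (tri<; tri≈; tri>)
open import Relation.Binary.PropositionalEquality
  using (_≡_; _≢_; refl; sym; trans; cong; cong₂; subst; module ≡-Reasoning)
open import Relation.Nullary.Decidable using (yes; no; dec-true; dec-false; _×-dec_)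
open import Relation.Nullary.Negation using (contradiction)
open import Relation.Unary using (_∈_)

open Sum ℤ.+-*-semiring
  using (sum-syntax; sum-cong-≗; ∑-comm; ∑-distrib-+; *-distribˡ-sum; *-distribʳ-sum)
  renaming (sum to sumℤ)
open ≡-Reasoning

private variable
  n v k l : ℕ

-- Invariance of projections under autotopies

tuples-complete : (t : Vec (Fin v) n) → t ∈ˡ tuples n v
tuples-complete []      = here refl
tuples-complete (i ∷ t) = ∈-cartesianProductWith⁺ _∷_ (∈-allFin i) (tuples-complete t)

tuples-unique : ∀ n v → Unique (tuples n v)
tuples-unique zero    v = [] ∷ []
tuples-unique (suc n) v =
  Unique.cartesianProductWith⁺ _∷_ ∷-injective (Unique.allFin⁺ v) (tuples-unique n v)

zipWith-inverseʳ : (π : Vec (Permutation′ v) n) (t : Vec (Fin v) n) →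
                   zipWith _⟨$⟩ˡ_ π (zipWith _⟨$⟩ʳ_ π t) ≡ t
zipWith-inverseʳ []      []      = refl
zipWith-inverseʳ (p ∷ π) (i ∷ t) = cong₂ _∷_ (inverseˡ p) (zipWith-inverseʳ π t)

zipWith-inverseˡ : (π : Vec (Permutation′ v) n) (t : Vec (Fin v) n) →
                   zipWith _⟨$⟩ʳ_ π (zipWith _⟨$⟩ˡ_ π t) ≡ t
zipWith-inverseˡ []      []      = refl
zipWith-inverseˡ (p ∷ π) (i ∷ t) = cong₂ _∷_ (inverseʳ p) (zipWith-inverseˡ π t)

-- The index list of the sum in `projection`, spelled identically so that the two agree by
-- unfolding.
fibre : Fin n → Fin n → Fin v → Fin v → List (Vec (Fin v) n)
fibre {n} {v} x y i j = filter (λ t → (lookup t x ≟ i) ×-dec (lookup t y ≟ j)) (tuples n v)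

-- The inverse components act bijectively on tuples and carry the constraint at `x` and `y` along.
-- Both lists are free of repetitions and have the same members, hence they differ only in order.
fibre-⟨$⟩ˡ : (π : Vec (Permutation′ v) n) (x y : Fin n) (i j : Fin v) →
             List.map (zipWith _⟨$⟩ˡ_ π) (fibre x y i j)
             ↭ fibre x y (lookup π x ⟨$⟩ˡ i) (lookup π y ⟨$⟩ˡ j)
fibre-⟨$⟩ˡ {v} {n} π x y i j = ∼bag⇒↭ $ unique∧set⇒bag
  (Unique.map⁺ φ-injective (Unique.filter⁺ _ (tuples-unique n v)))
  (Unique.filter⁺ _ (tuples-unique n v))
  (mk⇔ to from)
  where
  φ ψ : Vec (Fin v) n → Vec (Fin v) n
  φ = zipWith _⟨$⟩ˡ_ π
  ψ = zipWith _⟨$⟩ʳ_ π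

  φ-injective : ∀ {s t} → φ s ≡ φ t → s ≡ t
  φ-injective {s} {t} φs≡φt =
    trans (sym (zipWith-inverseˡ π s)) (trans (cong ψ φs≡φt) (zipWith-inverseˡ π t))

  lookup-φ : ∀ z {t h} → lookup t z ≡ h → lookup (φ t) z ≡ lookup π z ⟨$⟩ˡ h
  lookup-φ z {t} refl = lookup-zipWith _⟨$⟩ˡ_ z π t

  lookup-ψ : ∀ z {t h} → lookup t z ≡ lookup π z ⟨$⟩ˡ h → lookup (ψ t) z ≡ h
  lookup-ψ z {t} eq = trans (lookup-zipWith _⟨$⟩ʳ_ z π t)
    (trans (cong (lookup π z ⟨$⟩ʳ_) eq) (inverseʳ (lookup π z)))

  to : ∀ {t} → t ∈ˡ List.map φ (fibre x y i j) →
       t ∈ˡ fibre x y (lookup π x ⟨$⟩ˡ i) (lookup π y ⟨$⟩ˡ j)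
  to t∈ with s , s∈ , refl ← ∈-map⁻ φ t∈
        with _ , sx , sy ← ∈-filter⁻ _ {xs = tuples n v} s∈ =
    ∈-filter⁺ _ (tuples-complete (φ s)) (lookup-φ x sx , lookup-φ y sy)

  from : ∀ {t} → t ∈ˡ fibre x y (lookup π x ⟨$⟩ˡ i) (lookup π y ⟨$⟩ˡ j) →
         t ∈ˡ List.map φ (fibre x y i j)
  from {t} t∈ with _ , tx , ty ← ∈-filter⁻ _ {xs = tuples n v} t∈ =
    -- The preimage of `t` is `ψ t`.
    subst (_∈ˡ _) (zipWith-inverseʳ π t)
      (∈-map⁺ φ (∈-filter⁺ _ (tuples-complete (ψ t)) (lookup-ψ x tx , lookup-ψ y ty)))

-- Replacing each `C t` by its value at the moved tuple turns the sum over one fibre into a sum over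
-- the image of that fibre, which is again a fibre up to order.
projection-⟨$⟩ˡ : {C : Cube n v} {π : Vec (Permutation′ v) n} → IsAutotopy C π →
                  ∀ x y i j → projection x y C i j
                              ≡ projection x y C (lookup π x ⟨$⟩ˡ i) (lookup π y ⟨$⟩ˡ j)
projection-⟨$⟩ˡ {C = C} {π} autotopy x y i j = begin
  sum (List.map c (fibre x y i j))
    ≡⟨ cong sum (map-cong (λ t → cong toℕ (autotopy t)) (fibre x y i j)) ⟩
  sum (List.map (c ∘ zipWith _⟨$⟩ˡ_ π) (fibre x y i j))
    ≡⟨ cong sum (map-∘ (fibre x y i j)) ⟩
  sum (List.map c (List.map (zipWith _⟨$⟩ˡ_ π) (fibre x y i j)))
    ≡⟨ sum-↭ (↭.map⁺ c (fibre-⟨$⟩ˡ π x y i j)) ⟩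
  sum (List.map c (fibre x y (lookup π x ⟨$⟩ˡ i) (lookup π y ⟨$⟩ˡ j))) ∎
  where c = λ t → toℕ (C t)

-- Sums of integers

sum-nonNeg : (f : Fin n → ℤ) → (∀ i → 0ℤ ℤ.≤ f i) → 0ℤ ℤ.≤ sumℤ f
sum-nonNeg {n = zero}  f 0≤f = ℤ.≤-refl
sum-nonNeg {n = suc n} f 0≤f = ℤ.+-mono-≤ (0≤f zero) (sum-nonNeg (f ∘ suc) (0≤f ∘ suc))

+-nonNeg-≡0ˡ : ∀ {i j} → 0ℤ ℤ.≤ i → 0ℤ ℤ.≤ j → i ℤ.+ j ≡ 0ℤ → i ≡ 0ℤ
+-nonNeg-≡0ˡ {+ a} {+ b} _ _ eq = cong +_ (ℕ.m+n≡0⇒m≡0 a (ℤ.+-injective eq))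

-- Head and tail sum are nonnegative with sum zero, so both vanish. This is what extracts single
-- entries from a vanishing sum of squares.
sum-nonNeg-≡0 : (f : Fin n → ℤ) → (∀ i → 0ℤ ℤ.≤ f i) → sumℤ f ≡ 0ℤ → ∀ i → f i ≡ 0ℤ
sum-nonNeg-≡0 f 0≤f eq zero    =
  +-nonNeg-≡0ˡ (0≤f zero) (sum-nonNeg (f ∘ suc) (0≤f ∘ suc)) eq
sum-nonNeg-≡0 f 0≤f eq (suc i) = sum-nonNeg-≡0 (f ∘ suc) (0≤f ∘ suc)
  (+-nonNeg-≡0ˡ (sum-nonNeg (f ∘ suc) (0≤f ∘ suc)) (0≤f zero)
    (trans (ℤ.+-comm (sumℤ (f ∘ suc)) (f zero)) eq)) i

0≤i*i : ∀ i → 0ℤ ℤ.≤ i ℤ.* i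
0≤i*i (+ zero)     = +≤+ ℕ.z≤n
0≤i*i (+ suc _)    = +≤+ ℕ.z≤n
0≤i*i (ℤ.-[1+ _ ]) = +≤+ ℕ.z≤n

∑-distrib-- : (f g : Fin n → ℤ) → ∑[ i < n ] (f i ℤ.- g i) ≡ sumℤ f ℤ.- sumℤ g
∑-distrib-- {n = zero}  f g = refl
∑-distrib-- {n = suc n} f g = begin
  (f zero ℤ.- g zero) ℤ.+ sumℤ (λ i → f (suc i) ℤ.- g (suc i))
    ≡⟨ cong (ℤ._+_ (f zero ℤ.- g zero)) (∑-distrib-- (f ∘ suc) (g ∘ suc)) ⟩
  (f zero ℤ.- g zero) ℤ.+ (sumℤ (f ∘ suc) ℤ.- sumℤ (g ∘ suc))
    ≡⟨ interchange (f zero) (g zero) (sumℤ (f ∘ suc)) (sumℤ (g ∘ suc)) ⟩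
  (f zero ℤ.+ sumℤ (f ∘ suc)) ℤ.- (g zero ℤ.+ sumℤ (g ∘ suc)) ∎
  where
  interchange : ∀ a b c d → (a ℤ.- b) ℤ.+ (c ℤ.- d) ≡ (a ℤ.+ c) ℤ.- (b ℤ.+ d)
  interchange = solve-∀

sum-pos : (f : Fin n → ℕ) → + Sum.sum ℕ.+-*-semiring f ≡ sumℤ (λ i → + f i)
sum-pos {n = zero}  f = refl
sum-pos {n = suc n} f = trans (ℤ.pos-+ (f zero) _) (cong (ℤ._+_ (+ f zero)) (sum-pos (f ∘ suc)))

-- Integer matrices

private
  Matrixℤ : ℕ → Set
  Matrixℤ v = Fin v → Fin v → ℤ

-- The image of `I` in the integers, so that the Gram equation over the naturals transfers directly.
δ : Matrixℤ v
δ i j = + I i j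

I-diag : (i : Fin v) → I i i ≡ 1
I-diag i rewrite dec-true (i ≟ i) refl = refl

I-off-diag : {i j : Fin v} → i ≢ j → I i j ≡ 0
I-off-diag {i = i} {j} i≢j rewrite dec-false (i ≟ j) i≢j = refl

-- Induction on the index works because `δ (suc i) (suc j)` computes to `δ i j`.
∑-δ : (i : Fin v) (f : Fin v → ℤ) → ∑[ j < v ] (δ i j ℤ.* f j) ≡ f i
∑-δ {suc v} zero f = begin
  1ℤ ℤ.* f zero ℤ.+ ∑[ j < v ] (0ℤ ℤ.* f (suc j))
    ≡⟨ cong₂ ℤ._+_ (ℤ.*-identityˡ (f zero)) (sym (*-distribˡ-sum 0ℤ (f ∘ suc))) ⟩
  f zero ℤ.+ 0ℤ ℤ.* sumℤ (f ∘ suc)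
    ≡⟨ cong (ℤ._+_ (f zero)) (ℤ.*-zeroˡ (sumℤ (f ∘ suc))) ⟩
  f zero ℤ.+ 0ℤ
    ≡⟨ ℤ.+-identityʳ (f zero) ⟩
  f zero ∎
∑-δ {suc v} (suc i) f = begin
  0ℤ ℤ.* f zero ℤ.+ ∑[ j < v ] (δ i j ℤ.* f (suc j))
    ≡⟨ cong₂ ℤ._+_ (ℤ.*-zeroˡ (f zero)) (∑-δ i (f ∘ suc)) ⟩
  0ℤ ℤ.+ f (suc i)
    ≡⟨ ℤ.+-identityˡ (f (suc i)) ⟩
  f (suc i) ∎

infixl 7 _⊛_
_⊛_ : Matrixℤ v → Matrixℤ v → Matrixℤ v
_⊛_ {v} A B i j = ∑[ h < v ] (A i h ℤ.* B h j)

⊛-assoc : (A B C : Matrixℤ v) → ∀ i j → (A ⊛ B ⊛ C) i j ≡ (A ⊛ (B ⊛ C)) i j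
⊛-assoc {v} A B C i j = begin
  ∑[ g < v ] (∑[ h < v ] (A i h ℤ.* B h g) ℤ.* C g j)
    ≡⟨ sum-cong-≗ (λ g → *-distribʳ-sum (C g j) (λ h → A i h ℤ.* B h g)) ⟩
  ∑[ g < v ] ∑[ h < v ] (A i h ℤ.* B h g ℤ.* C g j)
    ≡⟨ ∑-comm (λ g h → A i h ℤ.* B h g ℤ.* C g j) ⟩
  ∑[ h < v ] ∑[ g < v ] (A i h ℤ.* B h g ℤ.* C g j)
    ≡⟨ sum-cong-≗ (λ h → sum-cong-≗ (λ g → ℤ.*-assoc (A i h) (B h g) (C g j))) ⟩
  ∑[ h < v ] ∑[ g < v ] (A i h ℤ.* (B h g ℤ.* C g j))
    ≡⟨ sum-cong-≗ (λ h → *-distribˡ-sum (A i h) (λ g → B h g ℤ.* C g j)) ⟨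
  ∑[ h < v ] (A i h ℤ.* (B ⊛ C) h j) ∎

trace-comm : (A B : Matrixℤ v) → ∑[ i < v ] (A ⊛ B) i i ≡ ∑[ i < v ] (B ⊛ A) i i
trace-comm {v} A B = begin
  ∑[ i < v ] ∑[ h < v ] (A i h ℤ.* B h i)
    ≡⟨ ∑-comm (λ i h → A i h ℤ.* B h i) ⟩
  ∑[ h < v ] ∑[ i < v ] (A i h ℤ.* B h i)
    ≡⟨ sum-cong-≗ (λ h → sum-cong-≗ (λ i → ℤ.*-comm (A i h) (B h i))) ⟩
  ∑[ h < v ] ∑[ i < v ] (B h i ℤ.* A i h) ∎

-- Two-sided inverses up to a scalar, by symmetry and trace

module _ (A B : Matrixℤ v) (d : ℤ)
  (AB≡d : ∀ i j → (A ⊛ B) i j ≡ d ℤ.* δ i j)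
  (BA-sym : ∀ i j → (B ⊛ A) i j ≡ (B ⊛ A) j i)
  where

  private
    P Q : Matrixℤ v
    P = B ⊛ A
    Q i j = d ℤ.* δ i j ℤ.- P i j

    A⊛P : ∀ i j → (A ⊛ P) i j ≡ d ℤ.* A i j
    A⊛P i j = begin
      (A ⊛ (B ⊛ A)) i j
        ≡⟨ ⊛-assoc A B A i j ⟨
      ∑[ h < v ] ((A ⊛ B) i h ℤ.* A h j)
        ≡⟨ sum-cong-≗ (λ h → trans (cong (ℤ._* A h j) (AB≡d i h)) (ℤ.*-assoc d (δ i h) (A h j))) ⟩
      ∑[ h < v ] (d ℤ.* (δ i h ℤ.* A h j))
        ≡⟨ *-distribˡ-sum d (λ h → δ i h ℤ.* A h j) ⟨
      d ℤ.* ∑[ h < v ] (δ i h ℤ.* A h j)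
        ≡⟨ cong (d ℤ.*_) (∑-δ i (λ h → A h j)) ⟩
      d ℤ.* A i j ∎

    -- Regrouping `BABA` around the inner `AB` makes `P` a scaled idempotent.
    P⊛P : ∀ i j → (P ⊛ P) i j ≡ d ℤ.* P i j
    P⊛P i j = begin
      (B ⊛ A ⊛ P) i j
        ≡⟨ ⊛-assoc B A P i j ⟩
      ∑[ h < v ] (B i h ℤ.* (A ⊛ P) h j)
        ≡⟨ sum-cong-≗ (λ h → trans (cong (B i h ℤ.*_) (A⊛P h j)) (swap (B i h) d (A h j))) ⟩
      ∑[ h < v ] (d ℤ.* (B i h ℤ.* A h j))
        ≡⟨ *-distribˡ-sum d (λ h → B i h ℤ.* A h j) ⟨
      d ℤ.* P i j ∎
      where
      swap : ∀ a b c → a ℤ.* (b ℤ.* c) ≡ b ℤ.* (a ℤ.* c)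
      swap = solve-∀

    -- A diagonal entry of `QQᵗ`. As `Q` is symmetric, this is `Q² = d²I - 2dP + P²`, which
    -- `P² = dP` reduces to `dQ`.
    row-norm : ∀ i → ∑[ j < v ] (Q i j ℤ.* Q i j) ≡ d ℤ.* Q i i
    row-norm i = begin
      ∑[ j < v ] (Q i j ℤ.* Q i j)
        -- Symmetry turns one factor `P i j` into `P j i`, so that the squares add up to a diagonal
        -- entry of `P ⊛ P`.
        ≡⟨ sum-cong-≗ (λ j → trans (expand (δ i j) (P i j))
             (cong (λ p → δ i j ℤ.* u j ℤ.+ P i j ℤ.* p) (BA-sym i j))) ⟩
      ∑[ j < v ] (δ i j ℤ.* u j ℤ.+ P i j ℤ.* P j i)
        ≡⟨ ∑-distrib-+ (λ j → δ i j ℤ.* u j) (λ j → P i j ℤ.* P j i) ⟩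
      ∑[ j < v ] (δ i j ℤ.* u j) ℤ.+ (P ⊛ P) i i
        ≡⟨ cong₂ ℤ._+_ (∑-δ i u) (P⊛P i i) ⟩
      u i ℤ.+ d ℤ.* P i i
        ≡⟨ collect d (δ i i) (P i i) ⟩
      d ℤ.* Q i i ∎
      where
      u : Fin v → ℤ
      -- The cofactor of `δ i j` in the expanded square; `∑-δ` then evaluates it at `i`.
      u j = d ℤ.* (d ℤ.* δ i j) ℤ.- + 2 ℤ.* (d ℤ.* P i j)
      expand′ : ∀ d e p → (d ℤ.* e ℤ.- p) ℤ.* (d ℤ.* e ℤ.- p)
                ≡ e ℤ.* (d ℤ.* (d ℤ.* e) ℤ.- + 2 ℤ.* (d ℤ.* p)) ℤ.+ p ℤ.* p
      expand′ = solve-∀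
      expand = expand′ d
      collect : ∀ d e p → d ℤ.* (d ℤ.* e) ℤ.- + 2 ℤ.* (d ℤ.* p) ℤ.+ d ℤ.* p
                ≡ d ℤ.* (d ℤ.* e ℤ.- p)
      collect = solve-∀

    -- `AB = dI` and `BA` have the same trace.
    trace-Q : ∑[ i < v ] Q i i ≡ 0ℤ
    trace-Q = begin
      ∑[ i < v ] Q i i
        ≡⟨ ∑-distrib-- (λ i → d ℤ.* δ i i) (λ i → P i i) ⟩
      ∑[ i < v ] (d ℤ.* δ i i) ℤ.- ∑[ i < v ] P i i
        ≡⟨ ℤ.i≡j⇒i-j≡0 (trans (sum-cong-≗ (λ i → sym (AB≡d i i))) (trace-comm A B)) ⟩
      0ℤ ∎

    norm : ∑[ i < v ] ∑[ j < v ] (Q i j ℤ.* Q i j) ≡ 0ℤ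
    norm = begin
      ∑[ i < v ] ∑[ j < v ] (Q i j ℤ.* Q i j) ≡⟨ sum-cong-≗ row-norm ⟩
      ∑[ i < v ] (d ℤ.* Q i i)                ≡⟨ *-distribˡ-sum d (λ i → Q i i) ⟨
      d ℤ.* ∑[ i < v ] Q i i                  ≡⟨ cong (d ℤ.*_) trace-Q ⟩
      d ℤ.* 0ℤ                                ≡⟨ ℤ.*-zeroʳ d ⟩
      0ℤ                                      ∎

  -- The trace of (dI - BA)(dI - BA)ᵗ = d(dI - BA) vanishes, so dI - BA = 0.
  symmetric-left-inverse : ∀ i j → (B ⊛ A) i j ≡ d ℤ.* δ i j
  symmetric-left-inverse i j = sym (ℤ.i-j≡0⇒i≡j _ _ Qij≡0)
    where
    Qij²≡0 : Q i j ℤ.* Q i j ≡ 0ℤ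
    Qij²≡0 = sum-nonNeg-≡0 (λ j → Q i j ℤ.* Q i j) (λ j → 0≤i*i (Q i j))
      (sum-nonNeg-≡0 (λ i → ∑[ j < v ] (Q i j ℤ.* Q i j))
        (λ i → sum-nonNeg (λ j → Q i j ℤ.* Q i j) (λ j → 0≤i*i (Q i j))) norm i) j
    Qij≡0 : Q i j ≡ 0ℤ
    Qij≡0 = [ id , id ]′ (ℤ.i*j≡0⇒i≡0∨j≡0 (Q i j) Qij²≡0)

-- Incidence matrices

module _ (A : Matrixℤ v) (ε μ : ℤ)
  (gramℤ : ∀ i j → ∑[ h < v ] (A i h ℤ.* A j h) ≡ ε ℤ.* δ i j ℤ.+ μ)
  where

  private
    -- The eigenvalue of the Gram matrix `εI + μJ` at the all-ones vector.
    α : ℤ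
    α = ε ℤ.+ ∑[ _ < v ] μ

    colSum : Fin v → ℤ
    colSum h = ∑[ g < v ] A g h

    -- The product `Aᵗ(αI - μJ)`. Since `α = ε + vμ`, the `J` terms of `(εI + μJ)(αI - μJ)` cancel
    -- and `αεI` remains: a right inverse of `A` up to a scalar, without division.
    B : Matrixℤ v
    B h j = α ℤ.* A j h ℤ.- μ ℤ.* colSum h

    -- Exchanging the two sums gives a row sum of the Gram matrix.
    ∑-A*colSum : ∀ i → ∑[ h < v ] (A i h ℤ.* colSum h) ≡ α
    ∑-A*colSum i = begin
      ∑[ h < v ] (A i h ℤ.* colSum h)
        ≡⟨ sum-cong-≗ (λ h → *-distribˡ-sum (A i h) (λ g → A g h)) ⟩
      ∑[ h < v ] ∑[ g < v ] (A i h ℤ.* A g h)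
        ≡⟨ ∑-comm (λ h g → A i h ℤ.* A g h) ⟩
      ∑[ g < v ] ∑[ h < v ] (A i h ℤ.* A g h)
        ≡⟨ sum-cong-≗ (λ g → trans (gramℤ i g) (cong (ℤ._+ μ) (ℤ.*-comm ε (δ i g)))) ⟩
      ∑[ g < v ] (δ i g ℤ.* ε ℤ.+ μ)
        ≡⟨ ∑-distrib-+ (λ g → δ i g ℤ.* ε) (λ _ → μ) ⟩
      ∑[ g < v ] (δ i g ℤ.* ε) ℤ.+ ∑[ _ < v ] μ
        ≡⟨ cong (ℤ._+ ∑[ _ < v ] μ) (∑-δ i (λ _ → ε)) ⟩
      α ∎

    AB : ∀ i j → (A ⊛ B) i j ≡ (α ℤ.* ε) ℤ.* δ i j
    AB i j = begin
      ∑[ h < v ] (A i h ℤ.* (α ℤ.* A j h ℤ.- μ ℤ.* colSum h))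
        ≡⟨ sum-cong-≗ (λ h → expand (A i h) α (A j h) μ (colSum h)) ⟩
      ∑[ h < v ] (α ℤ.* (A i h ℤ.* A j h) ℤ.- μ ℤ.* (A i h ℤ.* colSum h))
        ≡⟨ ∑-distrib-- (λ h → α ℤ.* (A i h ℤ.* A j h)) (λ h → μ ℤ.* (A i h ℤ.* colSum h)) ⟩
      ∑[ h < v ] (α ℤ.* (A i h ℤ.* A j h)) ℤ.- ∑[ h < v ] (μ ℤ.* (A i h ℤ.* colSum h))
        ≡⟨ cong₂ ℤ._-_ (*-distribˡ-sum α (λ h → A i h ℤ.* A j h))
                       (*-distribˡ-sum μ (λ h → A i h ℤ.* colSum h)) ⟨
      α ℤ.* ∑[ h < v ] (A i h ℤ.* A j h) ℤ.- μ ℤ.* ∑[ h < v ] (A i h ℤ.* colSum h)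
        ≡⟨ cong₂ (λ a b → α ℤ.* a ℤ.- μ ℤ.* b) (gramℤ i j) (∑-A*colSum i) ⟩
      α ℤ.* (ε ℤ.* δ i j ℤ.+ μ) ℤ.- μ ℤ.* α
        ≡⟨ cancel α ε (δ i j) μ ⟩
      (α ℤ.* ε) ℤ.* δ i j ∎
      where
      expand : ∀ a α b μ c → a ℤ.* (α ℤ.* b ℤ.- μ ℤ.* c) ≡ α ℤ.* (a ℤ.* b) ℤ.- μ ℤ.* (a ℤ.* c)
      expand = solve-∀
      cancel : ∀ α ε e μ → α ℤ.* (ε ℤ.* e ℤ.+ μ) ℤ.- μ ℤ.* α ≡ (α ℤ.* ε) ℤ.* e
      cancel = solve-∀

    -- A form in which symmetry is visible: `αAᵗA` minus `μ` times the outer product of the column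
    -- sums with themselves.
    BA : ∀ i j → (B ⊛ A) i j
                 ≡ α ℤ.* ∑[ h < v ] (A h i ℤ.* A h j) ℤ.- μ ℤ.* (colSum i ℤ.* colSum j)
    BA i j = begin
      ∑[ h < v ] ((α ℤ.* A h i ℤ.- μ ℤ.* colSum i) ℤ.* A h j)
        ≡⟨ sum-cong-≗ (λ h → expand α (A h i) μ (colSum i) (A h j)) ⟩
      ∑[ h < v ] (α ℤ.* (A h i ℤ.* A h j) ℤ.- μ ℤ.* colSum i ℤ.* A h j)
        ≡⟨ ∑-distrib-- (λ h → α ℤ.* (A h i ℤ.* A h j)) (λ h → μ ℤ.* colSum i ℤ.* A h j) ⟩
      ∑[ h < v ] (α ℤ.* (A h i ℤ.* A h j)) ℤ.- ∑[ h < v ] (μ ℤ.* colSum i ℤ.* A h j)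
        ≡⟨ cong₂ ℤ._-_ (*-distribˡ-sum α (λ h → A h i ℤ.* A h j))
                       (*-distribˡ-sum (μ ℤ.* colSum i) (λ h → A h j)) ⟨
      α ℤ.* ∑[ h < v ] (A h i ℤ.* A h j) ℤ.- μ ℤ.* colSum i ℤ.* colSum j
        ≡⟨ cong (ℤ._-_ (α ℤ.* ∑[ h < v ] (A h i ℤ.* A h j))) (ℤ.*-assoc μ (colSum i) (colSum j)) ⟩
      α ℤ.* ∑[ h < v ] (A h i ℤ.* A h j) ℤ.- μ ℤ.* (colSum i ℤ.* colSum j) ∎
      where
      expand : ∀ α a μ c b → (α ℤ.* a ℤ.- μ ℤ.* c) ℤ.* b ≡ α ℤ.* (a ℤ.* b) ℤ.- μ ℤ.* c ℤ.* b
      expand = solve-∀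

    BA-sym : ∀ i j → (B ⊛ A) i j ≡ (B ⊛ A) j i
    BA-sym i j = begin
      (B ⊛ A) i j
        ≡⟨ BA i j ⟩
      α ℤ.* ∑[ h < v ] (A h i ℤ.* A h j) ℤ.- μ ℤ.* (colSum i ℤ.* colSum j)
        ≡⟨ cong₂ (λ a b → α ℤ.* a ℤ.- μ ℤ.* b)
             (sum-cong-≗ (λ h → ℤ.*-comm (A h i) (A h j))) (ℤ.*-comm (colSum i) (colSum j)) ⟩
      α ℤ.* ∑[ h < v ] (A h j ℤ.* A h i) ℤ.- μ ℤ.* (colSum j ℤ.* colSum i)
        ≡⟨ BA j i ⟨
      (B ⊛ A) j i ∎

  -- Equal columns `i` and `j` of `A` give equal columns of `BA = αεI`. Comparing them in row `i`
  -- for `i ≢ j` gives `αε = 0`.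
  gram⇒columns-distinct : 0ℤ ℤ.< ε → 0ℤ ℤ.≤ μ →
                          ∀ {i j} → (∀ h → A h i ≡ A h j) → i ≡ j
  gram⇒columns-distinct 0<ε 0≤μ {i} {j} eq with i ≟ j
  ... | yes i≡j = i≡j
  ... | no  i≢j = contradiction αε≡0 αε≢0
    where
    α≢0 : α ≢ 0ℤ
    -- `α` is the positive `ε` plus `v` copies of the nonnegative `μ`.
    α≢0 = ℤ.<⇒≢ (ℤ.+-mono-<-≤ 0<ε (sum-nonNeg {v} (λ _ → μ) (λ _ → 0≤μ))) ∘ sym
    αε≢0 : α ℤ.* ε ≢ 0ℤ
    αε≢0 = [ α≢0 , ℤ.<⇒≢ 0<ε ∘ sym ]′ ∘ ℤ.i*j≡0⇒i≡0∨j≡0 α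
    left-inverse : ∀ i j → (B ⊛ A) i j ≡ (α ℤ.* ε) ℤ.* δ i j
    left-inverse = symmetric-left-inverse A B (α ℤ.* ε) AB BA-sym
    αε≡0 : α ℤ.* ε ≡ 0ℤ
    αε≡0 = begin
      α ℤ.* ε             ≡⟨ ℤ.*-identityʳ (α ℤ.* ε) ⟨
      α ℤ.* ε ℤ.* 1ℤ      ≡⟨ cong (λ e → α ℤ.* ε ℤ.* + e) (I-diag i) ⟨
      α ℤ.* ε ℤ.* δ i i   ≡⟨ left-inverse i i ⟨
      (B ⊛ A) i i         ≡⟨ sum-cong-≗ (λ h → cong (B i h ℤ.*_) (eq h)) ⟩
      (B ⊛ A) i j         ≡⟨ left-inverse i j ⟩
      α ℤ.* ε ℤ.* δ i j   ≡⟨ cong (λ e → α ℤ.* ε ℤ.* + e) (I-off-diag i≢j) ⟩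
      α ℤ.* ε ℤ.* 0ℤ      ≡⟨ ℤ.*-zeroʳ (α ℤ.* ε) ⟩
      0ℤ                  ∎

-- The scaled inverse involves subtraction, so the Gram equation is moved to the integers, with
-- `ε = k - l` and `μ = l`.
columns-distinct : {A : Matrix v v} → l < k → IsIncidenceMatrix v k l A →
                   ∀ {i j} → (∀ h → A h i ≡ A h j) → i ≡ j
columns-distinct {v} {l} {k} {A} l<k inc eq =
  gram⇒columns-distinct (λ i j → + A i j) (+ (k ℕ.∸ l)) (+ l) gramℤ
    (ℤ.+<+ (ℕ.m<n⇒0<n∸m l<k)) (+≤+ ℕ.z≤n) (λ h → cong +_ (eq h))
  where
  gramℤ : ∀ i j → ∑[ h < v ] (+ A i h ℤ.* + A j h) ≡ + (k ℕ.∸ l) ℤ.* δ i j ℤ.+ + l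
  gramℤ i j = begin
    ∑[ h < v ] (+ A i h ℤ.* + A j h)
      ≡⟨ sum-cong-≗ (λ h → ℤ.pos-* (A i h) (A j h)) ⟨
    ∑[ h < v ] (+ (A i h ℕ.* A j h))
      ≡⟨ sum-pos (λ h → A i h ℕ.* A j h) ⟨
    + (A ⊗ A ᵀ) i j
      ≡⟨ cong +_ (IsIncidenceMatrix.gram inc i j) ⟩
    + ((k ℕ.∸ l) ℕ.* I i j ℕ.+ l ℕ.* 1)
      ≡⟨ ℤ.pos-+ _ (l ℕ.* 1) ⟩
    + ((k ℕ.∸ l) ℕ.* I i j) ℤ.+ + (l ℕ.* 1)
      ≡⟨ cong₂ ℤ._+_ (ℤ.pos-* (k ℕ.∸ l) (I i j)) (cong +_ (ℕ.*-identityʳ l)) ⟩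
    + (k ℕ.∸ l) ℤ.* δ i j ℤ.+ + l ∎

-- If rows `i` and `j` agree, the `(i,i)` and `(i,j)` entries of `AAᵗ` are equal; for `i ≢ j` they
-- differ by `k - l`, which is positive.
rows-distinct : {A : Matrix v v} → l < k → IsIncidenceMatrix v k l A →
                ∀ {i j} → (∀ h → A i h ≡ A j h) → i ≡ j
rows-distinct {v} {l} {k} {A} l<k inc {i} {j} eq with i ≟ j
... | yes i≡j = i≡j
... | no  i≢j = contradiction (sym k∸l≡0) (ℕ.<⇒≢ (ℕ.m<n⇒0<n∸m l<k))
  where
  open IsIncidenceMatrix inc
  k∸l≡0 : k ℕ.∸ l ≡ 0
  -- The summand `l * 1` is the unfolded entry of `l · J`, common to both Gram entries.
  k∸l≡0 = ℕ.+-cancelʳ-≡ (l ℕ.* 1) (k ℕ.∸ l) 0 (begin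
    k ℕ.∸ l ℕ.+ l ℕ.* 1
      ≡⟨ cong (ℕ._+ l ℕ.* 1) (ℕ.*-identityʳ (k ℕ.∸ l)) ⟨
    (k ℕ.∸ l) ℕ.* 1 ℕ.+ l ℕ.* 1
      ≡⟨ cong (λ e → (k ℕ.∸ l) ℕ.* e ℕ.+ l ℕ.* 1) (I-diag i) ⟨
    (k ℕ.∸ l) ℕ.* I i i ℕ.+ l ℕ.* 1
      ≡⟨ gram i i ⟨
    (A ⊗ A ᵀ) i i
      ≡⟨ Sum.sum-cong-≗ ℕ.+-*-semiring (λ h → cong (A i h ℕ.*_) (eq h)) ⟩
    (A ⊗ A ᵀ) i j
      ≡⟨ gram i j ⟩
    (k ℕ.∸ l) ℕ.* I i j ℕ.+ l ℕ.* 1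
      ≡⟨ cong (λ e → (k ℕ.∸ l) ℕ.* e ℕ.+ l ℕ.* 1) (I-off-diag i≢j) ⟩
    (k ℕ.∸ l) ℕ.* 0 ℕ.+ l ℕ.* 1
      ≡⟨ cong (ℕ._+ l ℕ.* 1) (ℕ.*-zeroʳ (k ℕ.∸ l)) ⟩
    l ℕ.* 1 ∎)

-- `_≈_` compares forward maps whereas autotopies act through inverses; this lemma and the next
-- translate between the two.
≈⇒⟨$⟩ˡ : {π ρ : Permutation′ v} → π ≈ ρ → ∀ i → π ⟨$⟩ˡ i ≡ ρ ⟨$⟩ˡ i
≈⇒⟨$⟩ˡ {π = π} {ρ} π≈ρ i = begin
  π ⟨$⟩ˡ i                      ≡⟨ cong (π ⟨$⟩ˡ_) (inverseʳ ρ) ⟨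
  π ⟨$⟩ˡ (ρ ⟨$⟩ʳ (ρ ⟨$⟩ˡ i))    ≡⟨ cong (π ⟨$⟩ˡ_) (π≈ρ (ρ ⟨$⟩ˡ i)) ⟨
  π ⟨$⟩ˡ (π ⟨$⟩ʳ (ρ ⟨$⟩ˡ i))    ≡⟨ inverseˡ π ⟩
  ρ ⟨$⟩ˡ i                      ∎

⟨$⟩ˡ⇒≈ : {π ρ : Permutation′ v} → (∀ i → π ⟨$⟩ˡ i ≡ ρ ⟨$⟩ˡ i) → π ≈ ρ
⟨$⟩ˡ⇒≈ {π = π} {ρ} eq i = begin
  π ⟨$⟩ʳ i                      ≡⟨ inverseʳ ρ ⟨
  ρ ⟨$⟩ʳ (ρ ⟨$⟩ˡ (π ⟨$⟩ʳ i))    ≡⟨ cong (ρ ⟨$⟩ʳ_) (eq (π ⟨$⟩ʳ i)) ⟨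
  ρ ⟨$⟩ʳ (π ⟨$⟩ˡ (π ⟨$⟩ʳ i))    ≡⟨ cong (ρ ⟨$⟩ʳ_) (inverseˡ π) ⟩
  ρ ⟨$⟩ʳ i                      ∎

-- Autotopies sharing a component

module _ {C : Cube n v} {π ρ : Vec (Permutation′ v) n}
  (autπ : IsAutotopy C π) (autρ : IsAutotopy C ρ) {x : Fin n} (πₓ≈ρₓ : lookup π x ≈ lookup ρ x)
  where

  -- Both entries equal `projection x y C i j`, where `i` is the index that the inverse of the
  -- shared component sends to `h`.
  columns-agree : ∀ y h j → projection x y C h (lookup π y ⟨$⟩ˡ j)
                            ≡ projection x y C h (lookup ρ y ⟨$⟩ˡ j)
  columns-agree y h j = subst
    (λ g → projection x y C g (lookup π y ⟨$⟩ˡ j) ≡ projection x y C g (lookup ρ y ⟨$⟩ˡ j))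
    (inverseˡ (lookup π x)) (begin
      projection x y C (lookup π x ⟨$⟩ˡ i) (lookup π y ⟨$⟩ˡ j)
        ≡⟨ projection-⟨$⟩ˡ autπ x y i j ⟨
      projection x y C i j
        ≡⟨ projection-⟨$⟩ˡ autρ x y i j ⟩
      projection x y C (lookup ρ x ⟨$⟩ˡ i) (lookup ρ y ⟨$⟩ˡ j)
        ≡⟨ cong (λ g → projection x y C g (lookup ρ y ⟨$⟩ˡ j))
             (≈⇒⟨$⟩ˡ {π = lookup π x} {lookup ρ x} πₓ≈ρₓ i) ⟨
      projection x y C (lookup π x ⟨$⟩ˡ i) (lookup ρ y ⟨$⟩ˡ j) ∎)
    where i = lookup π x ⟨$⟩ʳ h

  -- The transposed counterpart: `𝒫` speaks of projections with increasing coordinates, so for `y`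
  -- before `x` the shared component acts on columns.
  rows-agree : ∀ y h j → projection y x C (lookup π y ⟨$⟩ˡ j) h
                         ≡ projection y x C (lookup ρ y ⟨$⟩ˡ j) h
  rows-agree y h j = subst
    (λ g → projection y x C (lookup π y ⟨$⟩ˡ j) g ≡ projection y x C (lookup ρ y ⟨$⟩ˡ j) g)
    (inverseˡ (lookup π x)) (begin
      projection y x C (lookup π y ⟨$⟩ˡ j) (lookup π x ⟨$⟩ˡ i)
        ≡⟨ projection-⟨$⟩ˡ autπ y x j i ⟨
      projection y x C j i
        ≡⟨ projection-⟨$⟩ˡ autρ y x j i ⟩
      projection y x C (lookup ρ y ⟨$⟩ˡ j) (lookup ρ x ⟨$⟩ˡ i)
        ≡⟨ cong (projection y x C (lookup ρ y ⟨$⟩ˡ j))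
             (≈⇒⟨$⟩ˡ {π = lookup π x} {lookup ρ x} πₓ≈ρₓ i) ⟨
      projection y x C (lookup ρ y ⟨$⟩ˡ j) (lookup π x ⟨$⟩ˡ i) ∎)
    where i = lookup π x ⟨$⟩ʳ h

proposition3p1 : ∀ (n v k l : ℕ) → 2 ≤ n → l < k →
    (C : Cube n v) → C ∈ 𝒫 n v k l →
    (π ρ : Vec (Permutation′ v) n) → IsAutotopy C π → IsAutotopy C ρ →
    (x : Fin n) → lookup π x ≈ lookup ρ x →
    (y : Fin n) → lookup π y ≈ lookup ρ y
proposition3p1 n v k l _ l<k C C∈𝒫 π ρ autπ autρ x πₓ≈ρₓ y with <-cmp x y
... | tri≈ _ refl _ = πₓ≈ρₓ
-- The indices of two equal columns coincide, so the inverses of the components at `y` agree at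
-- every `j`.
... | tri< x<y _ _  = ⟨$⟩ˡ⇒≈ {π = lookup π y} {lookup ρ y} λ j →
        columns-distinct l<k (C∈𝒫 x y x<y) (λ h → columns-agree autπ autρ πₓ≈ρₓ y h j)
... | tri> _ _ y<x  = ⟨$⟩ˡ⇒≈ {π = lookup π y} {lookup ρ y} λ j →
        rows-distinct l<k (C∈𝒫 y x y<x) (λ h → rows-agree autπ autρ πₓ≈ρₓ y h j)
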